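{- For any graph $G$ with at least one edge we have $$0\leq\alpha_{\rm es}(G)\leq\alpha(G)-1.$$
   Context: All graphs are finite and simple; $\alpha(G)$ is the independence number of $G$. For $B\subseteq V(G)$, $N[B]=\bigcup_{b\in B}N[b]$ and $N(B)=N[B]- B$. A set $B\subseteq V(G)$ is an externally supported independence set (ESI-set) if $B$ is independent and every $v\in N(B)$ has a neighbor in $V(G)- N[B]$ (the empty set is an ESI-set). The externally supported independence number $\alpha_{\rm es}(G)$ is the maximum cardinality of an ESI-set of $G$. -}

module Defs where

open import Data.Fin.Base using (Fin)
open import Data.Fin.Properties using (_≟_; all?; any?)
open import Data.Fin.Subset using (Subset; _∈_; _∉_; ⊥; ∣_∣)
open import Data.Fin.Subset.Properties using (_∈?_; ∉⊥; ∣p∣≤n; anySubset?)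
open import Data.Nat.Base using (ℕ; zero; suc; _≤_; s≤s⁻¹)
open import Data.Nat.Properties as ℕ using (n≤0⇒n≡0; ≤∧≢⇒<)
open import Data.Product.Base using (∃; _×_; _,_; proj₁)
open import Data.Sum.Base using (_⊎_)
open import Level using (0ℓ)
open import Relation.Binary.Core using (Rel)
open import Relation.Binary.Definitions as B using (Symmetric; Irreflexive)
open import Relation.Binary.PropositionalEquality.Core using (_≡_)
open import Relation.Nullary.Decidable.Core using (yes; no; _×-dec_; _⊎-dec_; _→-dec_; ¬?)
open import Relation.Nullary.Negation.Core using (¬_; contradiction)
open import Relation.Unary using (Pred; Decidable; Satisfiable)

-- Decidability of adjacency holds automatically in the classical setting;
-- here it is what makes α and αₑₛ below well-defined natural numbers.
record Graph : Set₁ where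
  field
    order  : ℕ

  Vertex : Set
  Vertex = Fin order

  field
    Adj    : Rel Vertex 0ℓ
    adj?   : B.Decidable Adj
    sym    : Symmetric Adj
    irrefl : Irreflexive _≡_ Adj

IsMaxCard : ∀ {n} → Pred (Subset n) 0ℓ → ℕ → Set
IsMaxCard P k = (∃ λ S → P S × ∣ S ∣ ≡ k) × (∀ S → P S → ∣ S ∣ ≤ k)

maxCard : ∀ {n} {P : Pred (Subset n) 0ℓ} →
          Decidable P → Satisfiable P → ∃ (IsMaxCard P)
maxCard {n} {P} P? (S₀ , pS₀) = search n λ S _ → ∣p∣≤n S
  where
  search : ∀ m → (∀ S → P S → ∣ S ∣ ≤ m) → ∃ (IsMaxCard P)
  search zero    bound = zero , (S₀ , pS₀ , n≤0⇒n≡0 (bound S₀ pS₀)) , bound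
  search (suc m) bound with anySubset? (λ S → P? S ×-dec (∣ S ∣ ℕ.≟ suc m))
  ... | yes attained = suc m , attained , bound
  ... | no  ¬attained = search m λ S pS →
    s≤s⁻¹ (≤∧≢⇒< (bound S pS) λ eq → ¬attained (S , pS , eq))

module _ (G : Graph) where
  open Graph G

  Independent : Pred (Subset order) 0ℓ
  Independent S = ∀ u → u ∈ S → ∀ v → v ∈ S → ¬ Adj u v

  -- v ∈ N[b]
  ClosedNbhd : Vertex → Pred Vertex 0ℓ
  ClosedNbhd b v = v ≡ b ⊎ Adj b v

  -- v ∈ N[S] = ⋃_{b ∈ S} N[b]
  ClosedNbhdOf : Subset order → Pred Vertex 0ℓ
  ClosedNbhdOf S v = ∃ λ b → b ∈ S × ClosedNbhd b v

  -- v ∈ N(S) = N[S] − S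
  OpenNbhdOf : Subset order → Pred Vertex 0ℓ
  OpenNbhdOf S v = ClosedNbhdOf S v × v ∉ S

  IsESI : Pred (Subset order) 0ℓ
  IsESI S = Independent S ×
    (∀ v → OpenNbhdOf S v → ∃ λ w → Adj v w × ¬ ClosedNbhdOf S w)

  independent? : Decidable Independent
  independent? S = all? λ u → (u ∈? S) →-dec
    (all? λ v → (v ∈? S) →-dec ¬? (adj? u v))

  closedNbhdOf? : ∀ S → Decidable (ClosedNbhdOf S)
  closedNbhdOf? S v = any? λ b → (b ∈? S) ×-dec ((v ≟ b) ⊎-dec adj? b v)

  isESI? : Decidable IsESI
  isESI? S = independent? S ×-dec
    (all? λ v → (closedNbhdOf? S v ×-dec ¬? (v ∈? S)) →-dec
      (any? λ w → adj? v w ×-dec ¬? (closedNbhdOf? S w)))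

  ⊥-independent : Independent ⊥
  ⊥-independent u u∈⊥ = contradiction u∈⊥ ∉⊥

  ⊥-isESI : IsESI ⊥
  ⊥-isESI = ⊥-independent , λ { v ((b , b∈⊥ , _) , _) → contradiction b∈⊥ ∉⊥ }

  maxIndependent : ∃ (IsMaxCard Independent)
  maxIndependent = maxCard independent? (⊥ , ⊥-independent)

  maxESI : ∃ (IsMaxCard IsESI)
  maxESI = maxCard isESI? (⊥ , ⊥-isESI)

  α : ℕ
  α = proj₁ maxIndependent

  αₑₛ : ℕ
  αₑₛ = proj₁ maxESI

{-# OPTIONS --safe #-}
-- If B is an ESI-set and some vertex lies outside B, then some vertex w lies
-- outside N[B], and B ∪ {w} is a larger independent set. An edge provides a
-- vertex outside B, since B cannot contain both of its ends.
module Submission where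

open import Defs
open import Data.Fin.Subset using (Subset; _∈_; _∉_; _∪_; ⁅_⁆; ∣_∣)
open import Data.Fin.Subset.Properties
  using (_∈?_; x∈p∪q⁻; p⊆p∪q; q⊆p∪q; x∈⁅x⁆; x∈⁅y⁆⇒x≡y; p⊂q⇒∣p∣<∣q∣)
open import Data.Integer.Base using (+_; 0ℤ; 1ℤ; _≤_; _-_; +≤+)
open import Data.Nat.Base as ℕ using (z≤n; s≤s)
open import Data.Nat.Properties using (<-≤-trans)
open import Data.Product.Base using (∃; ∃₂; _×_; _,_)
open import Data.Sum.Base using (inj₁; inj₂)
open import Relation.Binary.PropositionalEquality.Core using (refl)
open import Relation.Nullary.Decidable.Core using (yes; no)
open import Relation.Nullary.Negation.Core using (¬_)

-- Matching on `s≤s` exposes `n` as a successor, so the integer difference `+ n - 1ℤ` computes to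
-- its predecessor.
m<n⇒+m≤+n-1 : ∀ {m n} → m ℕ.< n → + m ≤ + n - 1ℤ
m<n⇒+m≤+n-1 (s≤s m≤n) = +≤+ m≤n

∣p∣<∣p∪⁅x⁆∣ : ∀ {n} (p : Subset n) {x} → x ∉ p → ∣ p ∣ ℕ.< ∣ p ∪ ⁅ x ⁆ ∣
∣p∣<∣p∪⁅x⁆∣ p {x} x∉p =
  p⊂q⇒∣p∣<∣q∣ (p⊆p∪q ⁅ x ⁆ , x , q⊆p∪q p ⁅ x ⁆ (x∈⁅x⁆ x) , x∉p)

module _ (G : Graph) where
  open Graph G

  -- An edge between `w` and `S`, in either direction by symmetry, would put `w` in N[S]; a loop at
  -- `w` contradicts irreflexivity.
  independent-∪⁅⁆ : ∀ {S w} → Independent G S → ¬ ClosedNbhdOf G S w →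
                    Independent G (S ∪ ⁅ w ⁆)
  independent-∪⁅⁆ {S} {w} indep w∉N[S] u u∈ v v∈ u~v
    with x∈p∪q⁻ S ⁅ w ⁆ u∈ | x∈p∪q⁻ S ⁅ w ⁆ v∈
  ... | inj₁ u∈S | inj₁ v∈S = indep u u∈S v v∈S u~v
  ... | inj₁ u∈S | inj₂ v∈w with refl ← x∈⁅y⁆⇒x≡y w v∈w =
    w∉N[S] (u , u∈S , inj₂ u~v)
  ... | inj₂ u∈w | inj₁ v∈S with refl ← x∈⁅y⁆⇒x≡y w u∈w =
    w∉N[S] (v , v∈S , inj₂ (sym u~v))
  ... | inj₂ u∈w | inj₂ v∈w
    with refl ← x∈⁅y⁆⇒x≡y w u∈w | refl ← x∈⁅y⁆⇒x≡y w v∈w = irrefl refl u~v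

  independent⇒∃∉ : ∃₂ Adj → ∀ {S} → Independent G S → ∃ λ v → v ∉ S
  independent⇒∃∉ (x , y , x~y) {S} indep with x ∈? S
  ... | no  x∉S = x , x∉S
  ... | yes x∈S = y , λ y∈S → indep x x∈S y y∈S x~y

  -- Either `v` itself avoids N[S], or it lies in N(S) and external support gives it a neighbor
  -- outside N[S].
  ESI⇒∃∉N[] : ∀ {S v} → IsESI G S → v ∉ S → ∃ λ w → ¬ ClosedNbhdOf G S w
  ESI⇒∃∉N[] {S} {v} (_ , support) v∉S with closedNbhdOf? G S v
  ... | no  v∉N[S] = v , v∉N[S]
  ... | yes v∈N[S] with w , _ , w∉N[S] ← support v (v∈N[S] , v∉S) = w , w∉N[S]

  αₑₛ<α : ∃₂ Adj → αₑₛ G ℕ.< α G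
  αₑₛ<α edge with maxESI G | maxIndependent G
  -- `B` is an ESI-set of maximum size; `refl` turns `αₑₛ G` into its cardinality.
  ... | _ , (B , esi@(indep , _) , refl) , _ | _ , _ , bound
    with v , v∉B ← independent⇒∃∉ edge indep
    with w , w∉N[B] ← ESI⇒∃∉N[] esi v∉B =
    -- The size grows strictly because B is contained in N[B], so `w` is not in `B`.
    <-≤-trans (∣p∣<∣p∪⁅x⁆∣ B λ w∈B → w∉N[B] (w , w∈B , inj₁ refl))
              (bound (B ∪ ⁅ w ⁆) (independent-∪⁅⁆ indep w∉N[B]))

theorem7 : (G : Graph) → ∃₂ (Graph.Adj G) →
    (0ℤ ≤ + (αₑₛ G)) × (+ (αₑₛ G) ≤ + (α G) - 1ℤ)
theorem7 G edge = +≤+ z≤n , m<n⇒+m≤+n-1 (αₑₛ<α G edge)
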